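{- Let $G$ be a group with finite generating set $S$, let $H$ be a finitely generated subgroup of $G$ with finite generating set $T$, and let $w\in(S\cup S^{ -1})^+$. Then: (i) the infinite snake, ouroboros and snake reachability problems for $(H,T)$ many-one reduce to the respective problems for $(G,S\cup T)$; (ii) the infinite snake, ouroboros and snake reachability problems for $(G,S)$ many-one reduce to the respective problems for $(G,S\cup\{\overline{w}\})$, where $\overline{w}$ is the element of $G$ represented by $w$.
   Context: For a group $K$ with finite generating set $U$: a tileset graph for $(K,U)$ is a finite multigraph $\Gamma=(A,B)$ with vertex set $A$ whose edges are triples $(a,a',s)$ with $a,a'\in A$ and $s\in U\cup U^{ -1}$, such that $(a,a',s)\in B$ implies $(a',a,s^{ -1})\in B$. Let $I$ be $\mathbb{Z}$, $\mathbb{N}$, or an integer interval $\llbracket n,m\rrbracket$. A $\Gamma$-snake is a pair $(\omega,\zeta)$ with $\omega:I\to K$ injective and $\zeta:I\to A$ such that for all $i,i+1\in I$, $d\omega_i:=\omega(i)^{ -1}\omega(i+1)\in U\cup U^{ -1}$ and $(\zeta(i),\zeta(i+1),d\omega_i)\in B$. It is bi-infinite if $I=\mathbb{Z}$; it connects $p,q$ if $I=\llbracket 0,n\rrbracket$, $\omega(0)=p$, $\omega(n)=q$. A $\Gamma$-ouroboros is such a pair on $\llbracket 0,n\rrbracket$, $n\ge 2$, with $\omega$ injective except $\omega(0)=\omega(n)$. The infinite snake problem for $(K,U)$: given $\Gamma$, is there a bi-infinite $\Gamma$-snake? The ouroboros problem: is there a $\Gamma$-ouroboros? The snake reachability problem: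 given $\Gamma$ and $p,q\in K$, is there a $\Gamma$-snake connecting $p$ and $q$? -}

module Defs where

open import Level using (Level; _⊔_; suc)
open import Data.Nat as ℕ using (ℕ; _≤_; _<_)
open import Data.Integer as ℤ using (ℤ)
open import Data.Fin using (Fin)
open import Data.Bool using (Bool; true; false)
open import Data.Product using (Σ; ∃; _×_; _,_)
open import Data.Sum using (_⊎_)
open import Data.List using (List; foldr)
open import Data.List.NonEmpty using (List⁺; toList)
open import Data.List.Membership.Propositional using (_∈_)
open import Relation.Binary.PropositionalEquality using (_≡_)
open import Function.Bundles using (_⇔_)
open import Algebra.Bundles using (Group)
import Data.Vec.Functional as VF
open import Algebra.Morphism.Structures using (module GroupMorphisms)

-- A letter of (U ∪ U⁻¹): index of a generator with a sign (true = U j, false = U j ⁻¹)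
Letter : ℕ → Set
Letter n = Fin n × Bool

-- Words over U ∪ U⁻¹ (used to give group elements as finite input data)
Word : ℕ → Set
Word n = List (Letter n)

-- Many-one reduction of problem P (on instances A) to problem Q (on instances B):
-- a (total, hence computable) Agda function f with  P x ⇔ Q (f x).
_≤ₘ_ : ∀ {a b p q} {A : Set a} {B : Set b} → (A → Set p) → (B → Set q) → Set (a ⊔ b ⊔ p ⊔ q)
_≤ₘ_ {A = A} {B = B} P Q = Σ (A → B) λ f → ∀ x → P x ⇔ Q (f x)

module _ {c ℓ} (K : Group c ℓ) where
  open Group K

  module _ {n : ℕ} (U : Fin n → Carrier) where

    val : Letter n → Carrier
    val (j , true)  = U j
    val (j , false) = U j ⁻¹

    eval : Word n → Carrier
    eval = foldr (λ l acc → val l ∙ acc) ε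

    Generates : Set (c ⊔ ℓ)
    Generates = ∀ x → ∃ λ (w : Word n) → eval w ≈ x

    -- A tileset graph for (K,U): vertex set A = Fin size, finite edge multiset given as a
    -- list of triples (a , a' , s) with s ∈ U ∪ U⁻¹ (given by a letter), closed under
    -- (a , a' , s) ↦ (a' , a , s⁻¹).
    record TilesetGraph : Set (c ⊔ ℓ) where
      field
        size  : ℕ
        edges : List (Fin size × Fin size × Letter n)
        symm  : ∀ {a a' l} → (a , a' , l) ∈ edges →
                ∃ λ l' → (a' , a , l') ∈ edges × val l' ≈ val l ⁻¹

    open TilesetGraph public

    Edge : (Γ : TilesetGraph) → Fin (size Γ) → Fin (size Γ) → Carrier → Set ℓ
    Edge Γ a a' g = ∃ λ l → (a , a' , l) ∈ edges Γ × val l ≈ g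

    d : {I : Set} → (I → Carrier) → I → I → Carrier
    d ω i i' = ω i ⁻¹ ∙ ω i'

    BiInfiniteSnake : TilesetGraph → Set (c ⊔ ℓ)
    BiInfiniteSnake Γ =
      Σ (ℤ → Carrier) λ ω → Σ (ℤ → Fin (size Γ)) λ ζ →
        (∀ i j → ω i ≈ ω j → i ≡ j) ×
        (∀ i → Edge Γ (ζ i) (ζ (ℤ.suc i)) (d ω i (ℤ.suc i)))

    -- Γ-snake on ⟦0,len⟧ (values of ω, ζ outside ⟦0,len⟧ are irrelevant)
    FiniteSnake : (Γ : TilesetGraph) → ℕ → (ℕ → Carrier) → (ℕ → Fin (size Γ)) → Set ℓ
    FiniteSnake Γ len ω ζ =
      (∀ i j → i ≤ len → j ≤ len → ω i ≈ ω j → i ≡ j) ×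
      (∀ i → i < len → Edge Γ (ζ i) (ζ (ℕ.suc i)) (d ω i (ℕ.suc i)))

    Ouroboros : TilesetGraph → Set (c ⊔ ℓ)
    Ouroboros Γ =
      Σ ℕ λ len → Σ (ℕ → Carrier) λ ω → Σ (ℕ → Fin (size Γ)) λ ζ →
        2 ≤ len × ω 0 ≈ ω len ×
        (∀ i j → i ≤ len → j ≤ len → ω i ≈ ω j →
           i ≡ j ⊎ (i ≡ 0 × j ≡ len) ⊎ (i ≡ len × j ≡ 0)) ×
        (∀ i → i < len → Edge Γ (ζ i) (ζ (ℕ.suc i)) (d ω i (ℕ.suc i)))

    Connects : (Γ : TilesetGraph) → Carrier → Carrier → Set (c ⊔ ℓ)
    Connects Γ p q =
      Σ ℕ λ len → Σ (ℕ → Carrier) λ ω → Σ (ℕ → Fin (size Γ)) λ ζ →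
        FiniteSnake Γ len ω ζ × ω 0 ≈ p × ω len ≈ q

    InfiniteSnakeProblem : TilesetGraph → Set (c ⊔ ℓ)
    InfiniteSnakeProblem Γ = BiInfiniteSnake Γ

    OuroborosProblem : TilesetGraph → Set (c ⊔ ℓ)
    OuroborosProblem Γ = Ouroboros Γ

    ReachabilityProblem : TilesetGraph × Word n × Word n → Set (c ⊔ ℓ)
    ReachabilityProblem (Γ , p , q) = Connects Γ (eval p) (eval q)

  -- H is a subgroup of G: given via an injective group homomorphism ι : H → G
  IsSubgroupEmbedding : ∀ {c' ℓ'} (H : Group c' ℓ') → (Group.Carrier H → Carrier) → Set (c' ⊔ ℓ' ⊔ ℓ)
  IsSubgroupEmbedding H ι = GroupMorphisms.IsGroupMonomorphism (Group.rawGroup H) rawGroup ι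

_∪ᵍ_ : ∀ {c} {C : Set c} {n m} → (Fin n → C) → (Fin m → C) → Fin (n ℕ.+ m) → C
S ∪ᵍ T = S VF.++ T

{-# OPTIONS --safe #-}
module Submission where

-- Both parts are instances of one transfer principle. Let φ : H → G be a group monomorphism and
-- send every letter of (H, U) to a letter of (G, V) whose value is φ of its value. Relabelling the
-- edges of a tileset graph Γ along this letter map gives a graph Γ' such that φ maps Γ-snakes to
-- Γ'-snakes. Conversely every step of a Γ'-snake is the φ-image of a generator of H, so multiplying
-- these preimages up yields a Γ-snake whose φ-image is a left translate of the given one (the given
-- one itself when its start is prescribed, as for reachability). Since φ is injective and left
-- translation is a bijection, coincidences of positions are the same on both sides.
-- Part (i) uses the inclusion H ↪ G, part (ii) the identity of G.

open import Defs
open import Data.Nat as ℕ using (ℕ; zero; suc; _≤_; _<_; z≤n; _+_)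
open import Data.Nat.Properties using (_<?_; ≤-refl; <⇒≤)
open import Data.Integer as ℤ using (ℤ; +_; -[1+_])
open import Data.Fin using (Fin; _↑ʳ_; _↑ˡ_)
open import Data.Fin.Properties using (splitAt-↑ʳ; splitAt-↑ˡ)
open import Data.Bool using (true; false)
open import Data.Product using (Σ; ∃; _×_; _,_; proj₁; proj₂; map₁; map₂)
open import Data.List using (List; []; _∷_; map)
open import Data.List.NonEmpty using (List⁺; toList)
open import Data.List.Membership.Propositional using (_∈_)
open import Data.List.Membership.Propositional.Properties using (∈-map⁺; ∈-map⁻)
open import Function using (_∘_)
open import Function.Bundles using (mk⇔)
open import Relation.Binary.PropositionalEquality as ≡ using (_≡_; cong)
open import Relation.Nullary using (yes; no)
open import Relation.Nullary.Negation using (contradiction)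
open import Algebra.Bundles using (Group)
open import Algebra.Morphism.Structures using (module GroupMorphisms)
import Algebra.Morphism.Construct.Identity as Identity
import Algebra.Properties.Group as GroupProperties
import Algebra.Properties.Monoid as MonoidProperties
import Relation.Binary.Reasoning.Setoid as SetoidReasoning

suc-[1+] : ∀ k → ℤ.suc -[1+ k ] ≡ ℤ.- (+ k)
suc-[1+] zero    = ≡.refl
suc-[1+] (suc k) = ≡.refl

shiftˡ : ∀ {n} m → Letter n → Letter (n + m)
shiftˡ m = map₁ (_↑ˡ m)

shiftʳ : ∀ n {m} → Letter m → Letter (n + m)
shiftʳ n = map₁ (n ↑ʳ_)

module _ {c ℓ} (G : Group c ℓ) {n m : ℕ} (S : Fin n → Group.Carrier G) (T : Fin m → Group.Carrier G) where

  val-∪ᵍ-shiftˡ : ∀ l → val G (S ∪ᵍ T) (shiftˡ m l) ≡ val G S l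
  val-∪ᵍ-shiftˡ (j , true)  rewrite splitAt-↑ˡ n j m = ≡.refl
  val-∪ᵍ-shiftˡ (j , false) rewrite splitAt-↑ˡ n j m = ≡.refl

  val-∪ᵍ-shiftʳ : ∀ l → val G (S ∪ᵍ T) (shiftʳ n l) ≡ val G T l
  val-∪ᵍ-shiftʳ (j , true)  rewrite splitAt-↑ʳ n m j = ≡.refl
  val-∪ᵍ-shiftʳ (j , false) rewrite splitAt-↑ʳ n m j = ≡.refl

module _ {c ℓ c' ℓ'} {H : Group c' ℓ'} {G : Group c ℓ} {φ : Group.Carrier H → Group.Carrier G}
  (φ-hom : GroupMorphisms.IsGroupHomomorphism (Group.rawGroup H) (Group.rawGroup G) φ) where

  open Group G
  open GroupMorphisms.IsGroupHomomorphism φ-hom using (⁻¹-homo)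

  val-homo : ∀ {m} (T : Fin m → Group.Carrier H) l → val G (φ ∘ T) l ≈ φ (val H T l)
  val-homo T (j , true)  = refl
  val-homo T (j , false) = sym (⁻¹-homo (T j))

module Relabel {c ℓ c' ℓ'} {H : Group c' ℓ'} {G : Group c ℓ} {φ : Group.Carrier H → Group.Carrier G}
  (φ-mono : GroupMorphisms.IsGroupMonomorphism (Group.rawGroup H) (Group.rawGroup G) φ)
  {n n' : ℕ} (U : Fin n → Group.Carrier H) (V : Fin n' → Group.Carrier G)
  (e : Letter n → Letter n')
  (val-e : ∀ l → Group._≈_ G (val G V (e l)) (φ (val H U l))) where

  private module H = Group H
  open Group G
  open GroupMorphisms.IsGroupMonomorphism φ-mono
  open GroupProperties G using (⁻¹-anti-homo-∙; ⁻¹-anti-homo-\\; ∙-cancelˡ)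
  open MonoidProperties monoid using (cancelᶜ)
  open SetoidReasoning setoid

  relabel : TilesetGraph H U → TilesetGraph G V
  relabel Γ = record
    { size  = TilesetGraph.size Γ
    ; edges = edges′
    ; symm  = relabel-symm
    }
    where
    edges′ : List (Fin (TilesetGraph.size Γ) × Fin (TilesetGraph.size Γ) × Letter n')
    edges′ = map (map₂ (map₂ e)) (TilesetGraph.edges Γ)

    relabel-symm : ∀ {a a' l} → (a , a' , l) ∈ edges′ → ∃ λ l' → (a' , a , l') ∈ edges′ × val G V l' ≈ val G V l ⁻¹
    relabel-symm mem with ∈-map⁻ (map₂ (map₂ e)) mem
    ... | (_ , _ , l) , mem₁ , ≡.refl with TilesetGraph.symm Γ mem₁
    ... | l' , mem₂ , l'≈l⁻¹ = e l' , ∈-map⁺ (map₂ (map₂ e)) mem₂ , (begin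
      val G V (e l')      ≈⟨ val-e l' ⟩
      φ (val H U l')      ≈⟨ ⟦⟧-cong l'≈l⁻¹ ⟩
      φ (val H U l H.⁻¹)  ≈⟨ ⁻¹-homo _ ⟩
      φ (val H U l) ⁻¹    ≈⟨ ⁻¹-cong (val-e l) ⟨
      val G V (e l) ⁻¹    ∎)

  φ-step : ∀ x y → φ (x H.⁻¹ H.∙ y) ≈ φ x ⁻¹ ∙ φ y
  φ-step x y = trans (∙-homo _ _) (∙-congʳ (⁻¹-homo x))

  relabel-edge : ∀ Γ {a a' x} → Edge H U Γ a a' x → Edge G V (relabel Γ) a a' (φ x)
  relabel-edge Γ (l , mem , l≈x) = e l , ∈-map⁺ (map₂ (map₂ e)) mem , trans (val-e l) (⟦⟧-cong l≈x)

  relabel-edge⁻ : ∀ Γ {a a' y} → Edge G V (relabel Γ) a a' y →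
                  Σ (Letter n) λ l → (a , a' , l) ∈ TilesetGraph.edges Γ × φ (val H U l) ≈ y
  relabel-edge⁻ Γ (_ , mem , l≈y) with ∈-map⁻ (map₂ (map₂ e)) mem
  ... | (_ , _ , l) , mem₁ , ≡.refl = l , mem₁ , trans (sym (val-e l)) l≈y

  edge-preimage : ∀ Γ {a a' y} → Edge G V (relabel Γ) a a' y → Σ H.Carrier λ x → φ x ≈ y
  edge-preimage Γ edge = let l , _ , φl≈y = relabel-edge⁻ Γ edge in val H U l , φl≈y

  unrelabel-edge : ∀ Γ {a a' x y} → Edge G V (relabel Γ) a a' y → φ x ≈ y → Edge H U Γ a a' x
  unrelabel-edge Γ edge φx≈y =
    let l , mem , φl≈y = relabel-edge⁻ Γ edge in l , mem , injective (trans φl≈y (sym φx≈y))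

  -- "φ x ≈ c ∙ u" says that x lifts u along φ, up to the left translation by c.
  lift-injective : ∀ {c x y u v} → φ x ≈ c ∙ u → φ y ≈ c ∙ v → x H.≈ y → u ≈ v
  lift-injective {c} {x} {y} {u} {v} φx φy x≈y = ∙-cancelˡ c u v (begin
    c ∙ u  ≈⟨ φx ⟨
    φ x    ≈⟨ ⟦⟧-cong x≈y ⟩
    φ y    ≈⟨ φy ⟩
    c ∙ v  ∎)

  lift-cong : ∀ {c x y u v} → φ x ≈ c ∙ u → φ y ≈ c ∙ v → u ≈ v → x H.≈ y
  lift-cong φx φy u≈v = injective (trans φx (trans (∙-congˡ u≈v) (sym φy)))

  lift-step : ∀ {c x y u v} → φ x ≈ c ∙ u → φ y ≈ c ∙ v → φ (x H.⁻¹ H.∙ y) ≈ u ⁻¹ ∙ v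
  lift-step {c} {x} {y} {u} {v} φx φy = begin
    φ (x H.⁻¹ H.∙ y)          ≈⟨ φ-step x y ⟩
    φ x ⁻¹ ∙ φ y              ≈⟨ ∙-cong (⁻¹-cong φx) φy ⟩
    (c ∙ u) ⁻¹ ∙ (c ∙ v)      ≈⟨ ∙-congʳ (⁻¹-anti-homo-∙ c u) ⟩
    (u ⁻¹ ∙ c ⁻¹) ∙ (c ∙ v)   ≈⟨ cancelᶜ (inverseˡ c) (u ⁻¹) v ⟩
    u ⁻¹ ∙ v                  ∎

  lift-base : ∀ u → φ H.ε ≈ u ⁻¹ ∙ u
  lift-base u = trans ε-homo (sym (inverseˡ u))

  walk : H.Carrier → (ℕ → H.Carrier) → ℕ → H.Carrier
  walk b g zero    = b
  walk b g (suc k) = walk b g k H.∙ g k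

  walk-lift : ∀ {b c len} {g : ℕ → H.Carrier} (ω : ℕ → Carrier) → φ b ≈ c ∙ ω 0 →
              (∀ k → k < len → φ (g k) ≈ ω k ⁻¹ ∙ ω (suc k)) →
              ∀ k → k ≤ len → φ (walk b g k) ≈ c ∙ ω k
  walk-lift ω base steps zero    _   = base
  walk-lift {b} {c} {g = g} ω base steps (suc k) k<len = begin
    φ (walk b g k H.∙ g k)             ≈⟨ ∙-homo _ _ ⟩
    φ (walk b g k) ∙ φ (g k)           ≈⟨ ∙-cong (walk-lift ω base steps k (<⇒≤ k<len)) (steps k k<len) ⟩
    (c ∙ ω k) ∙ (ω k ⁻¹ ∙ ω (suc k))   ≈⟨ cancelᶜ (inverseʳ (ω k)) c (ω (suc k)) ⟩
    c ∙ ω (suc k)                      ∎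

  module _ (Γ : TilesetGraph H U) {len : ℕ} {ω : ℕ → Carrier} {ζ : ℕ → Fin (TilesetGraph.size Γ)}
    (steps : ∀ i → i < len → Edge G V (relabel Γ) (ζ i) (ζ (suc i)) (d G V ω i (suc i))) where

    lift-path : ∀ b c → φ b ≈ c ∙ ω 0 → Σ (ℕ → H.Carrier) λ χ → ∀ k → k ≤ len → φ (χ k) ≈ c ∙ ω k
    lift-path b c base = walk b g , walk-lift ω base g-steps
      where
      g : ℕ → H.Carrier
      g k with k <? len
      ... | yes k<len = proj₁ (edge-preimage Γ (steps k k<len))
      ... | no  _     = H.ε

      g-steps : ∀ k → k < len → φ (g k) ≈ ω k ⁻¹ ∙ ω (suc k)
      g-steps k k<len with k <? len
      ... | yes k<len′ = proj₂ (edge-preimage Γ (steps k k<len′))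
      ... | no  k≮len  = contradiction k<len k≮len

    unrelabel-steps : ∀ {c} {χ : ℕ → H.Carrier} → (∀ k → k ≤ len → φ (χ k) ≈ c ∙ ω k) →
                      ∀ i → i < len → Edge H U Γ (ζ i) (ζ (suc i)) (d H U χ i (suc i))
    unrelabel-steps lifts i i<len =
      unrelabel-edge Γ (steps i i<len) (lift-step (lifts i (<⇒≤ i<len)) (lifts (suc i) i<len))

  lift-biInfinite : ∀ Γ {ω : ℤ → Carrier} {ζ : ℤ → Fin (TilesetGraph.size Γ)} →
    (∀ i → Edge G V (relabel Γ) (ζ i) (ζ (ℤ.suc i)) (d G V ω i (ℤ.suc i))) →
    Σ (ℤ → H.Carrier) λ χ → ∀ i → φ (χ i) ≈ ω (+ 0) ⁻¹ ∙ ω i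
  lift-biInfinite Γ {ω} steps = χ , lifts
    where
    preimage : ∀ i → Σ H.Carrier λ x → φ x ≈ ω i ⁻¹ ∙ ω (ℤ.suc i)
    preimage i = edge-preimage Γ (steps i)

    forward backward : ℕ → H.Carrier
    forward  k = proj₁ (preimage (+ k))
    backward k = proj₁ (preimage -[1+ k ]) H.⁻¹

    backward-step : ∀ k → φ (backward k) ≈ ω (ℤ.- (+ k)) ⁻¹ ∙ ω (ℤ.- (+ suc k))
    backward-step k = begin
      φ (backward k)                                      ≈⟨ ⁻¹-homo _ ⟩
      φ (proj₁ (preimage -[1+ k ])) ⁻¹                    ≈⟨ ⁻¹-cong (proj₂ (preimage -[1+ k ])) ⟩
      (ω -[1+ k ] ⁻¹ ∙ ω (ℤ.suc -[1+ k ])) ⁻¹              ≈⟨ ⁻¹-anti-homo-\\ _ _ ⟩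
      ω (ℤ.suc -[1+ k ]) ⁻¹ ∙ ω -[1+ k ]                  ≡⟨ cong (λ i → ω i ⁻¹ ∙ ω -[1+ k ]) (suc-[1+] k) ⟩
      ω (ℤ.- (+ k)) ⁻¹ ∙ ω (ℤ.- (+ suc k))               ∎

    χ : ℤ → H.Carrier
    χ (+ k)    = walk H.ε forward k
    χ -[1+ k ] = walk H.ε backward (suc k)

    lifts : ∀ i → φ (χ i) ≈ ω (+ 0) ⁻¹ ∙ ω i
    lifts (+ k)    = walk-lift (ω ∘ +_) (lift-base _) (λ j _ → proj₂ (preimage (+ j))) k ≤-refl
    lifts -[1+ k ] = walk-lift (ω ∘ ℤ.-_ ∘ +_) (lift-base _) (λ j _ → backward-step j) (suc k) ≤-refl

  eval-relabel : ∀ p → eval G V (map e p) ≈ φ (eval H U p)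
  eval-relabel []      = sym ε-homo
  eval-relabel (l ∷ p) = trans (∙-cong (val-e l) (eval-relabel p)) (sym (∙-homo _ _))

  relabel-step : ∀ Γ {I : Set} (χ : I → H.Carrier) {a a' i j} → Edge H U Γ a a' (d H U χ i j) →
                 Edge G V (relabel Γ) a a' (d G V (φ ∘ χ) i j)
  relabel-step Γ χ edge = let l , mem , eq = relabel-edge Γ edge in l , mem , trans eq (φ-step _ _)

  infiniteSnake-reduction : InfiniteSnakeProblem H U ≤ₘ InfiniteSnakeProblem G V
  infiniteSnake-reduction = relabel , λ Γ → mk⇔ (to Γ) (from Γ)
    where
    to : ∀ Γ → BiInfiniteSnake H U Γ → BiInfiniteSnake G V (relabel Γ)
    to Γ (χ , ζ , inj , edges) = φ ∘ χ , ζ , (λ i j → inj i j ∘ injective) , relabel-step Γ χ ∘ edges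

    from : ∀ Γ → BiInfiniteSnake G V (relabel Γ) → BiInfiniteSnake H U Γ
    from Γ (ω , ζ , inj , steps) =
      let χ , lifts = lift-biInfinite Γ steps in
      χ , ζ , (λ i j → inj i j ∘ lift-injective (lifts i) (lifts j)) ,
      λ i → unrelabel-edge Γ (steps i) (lift-step (lifts i) (lifts (ℤ.suc i)))

  ouroboros-reduction : OuroborosProblem H U ≤ₘ OuroborosProblem G V
  ouroboros-reduction = relabel , λ Γ → mk⇔ (to Γ) (from Γ)
    where
    to : ∀ Γ → Ouroboros H U Γ → Ouroboros G V (relabel Γ)
    to Γ (len , χ , ζ , 2≤len , closed , inj , edges) =
      len , φ ∘ χ , ζ , 2≤len , ⟦⟧-cong closed , (λ i j i≤ j≤ → inj i j i≤ j≤ ∘ injective) ,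
      λ i i<len → relabel-step Γ χ (edges i i<len)

    from : ∀ Γ → Ouroboros G V (relabel Γ) → Ouroboros H U Γ
    from Γ (len , ω , ζ , 2≤len , closed , inj , steps) =
      let χ , lifts = lift-path Γ steps H.ε (ω 0 ⁻¹) (lift-base _) in
      len , χ , ζ , 2≤len , lift-cong (lifts 0 z≤n) (lifts len ≤-refl) closed ,
      (λ i j i≤ j≤ → inj i j i≤ j≤ ∘ lift-injective (lifts i i≤) (lifts j j≤)) ,
      unrelabel-steps Γ steps lifts

  reachability-reduction : ReachabilityProblem H U ≤ₘ ReachabilityProblem G V
  reachability-reduction =
    (λ (Γ , p , q) → relabel Γ , map e p , map e q) , λ (Γ , p , q) → mk⇔ (to Γ p q) (from Γ p q)
    where
    to : ∀ Γ p q → Connects H U Γ (eval H U p) (eval H U q) →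
         Connects G V (relabel Γ) (eval G V (map e p)) (eval G V (map e q))
    to Γ p q (len , χ , ζ , (inj , edges) , start , end) =
      len , φ ∘ χ , ζ ,
      ((λ i j i≤ j≤ → inj i j i≤ j≤ ∘ injective) , λ i i<len → relabel-step Γ χ (edges i i<len)) ,
      trans (⟦⟧-cong start) (sym (eval-relabel p)) , trans (⟦⟧-cong end) (sym (eval-relabel q))

    from : ∀ Γ p q → Connects G V (relabel Γ) (eval G V (map e p)) (eval G V (map e q)) →
           Connects H U Γ (eval H U p) (eval H U q)
    from Γ p q (len , ω , ζ , (inj , steps) , start , end) =
      let χ , lifts = lift-path Γ steps (eval H U p) ε (eval-lift p start) in
      len , χ , ζ ,
      ((λ i j i≤ j≤ → inj i j i≤ j≤ ∘ lift-injective (lifts i i≤) (lifts j j≤)) ,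
       unrelabel-steps Γ steps lifts) ,
      lift-cong (lifts 0 z≤n) (eval-lift p start) refl , lift-cong (lifts len ≤-refl) (eval-lift q end) refl
      where
      eval-lift : ∀ {u} p′ → u ≈ eval G V (map e p′) → φ (eval H U p′) ≈ ε ∙ u
      eval-lift {u} p′ u≈p′ = trans (sym (eval-relabel p′)) (trans (sym u≈p′) (sym (identityˡ u)))

lemma1 : ∀ {c ℓ c' ℓ'} (G : Group c ℓ) {n : ℕ} (S : Fin n → Group.Carrier G) → Generates G S →
    (H : Group c' ℓ') (ι : Group.Carrier H → Group.Carrier G) → IsSubgroupEmbedding G H ι →
    {m : ℕ} (T : Fin m → Group.Carrier H) → Generates H T →
    (w : List⁺ (Letter n)) →
    -- (i)
    ((InfiniteSnakeProblem H T ≤ₘ InfiniteSnakeProblem G (S ∪ᵍ (λ j → ι (T j))))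
      × (OuroborosProblem H T ≤ₘ OuroborosProblem G (S ∪ᵍ (λ j → ι (T j))))
      × (ReachabilityProblem H T ≤ₘ ReachabilityProblem G (S ∪ᵍ (λ j → ι (T j)))))
    ×
    -- (ii)
    ((InfiniteSnakeProblem G S ≤ₘ InfiniteSnakeProblem G (S ∪ᵍ (λ (_ : Fin 1) → eval G S (toList w))))
      × (OuroborosProblem G S ≤ₘ OuroborosProblem G (S ∪ᵍ (λ (_ : Fin 1) → eval G S (toList w))))
      × (ReachabilityProblem G S ≤ₘ ReachabilityProblem G (S ∪ᵍ (λ (_ : Fin 1) → eval G S (toList w)))))
lemma1 G {n} S _ H ι ι-mono {m} T _ w =
  (Sub.infiniteSnake-reduction , Sub.ouroboros-reduction , Sub.reachability-reduction) ,
  (Ext.infiniteSnake-reduction , Ext.ouroboros-reduction , Ext.reachability-reduction)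
  where
  open Group G using (refl; trans; reflexive)
  open GroupMorphisms.IsGroupMonomorphism ι-mono using (isGroupHomomorphism)

  ιT : Fin m → Group.Carrier G
  ιT j = ι (T j)

  w̄ : Fin 1 → Group.Carrier G
  w̄ _ = eval G S (toList w)

  module Sub = Relabel ι-mono T (S ∪ᵍ ιT) (shiftʳ n)
    (λ l → trans (reflexive (val-∪ᵍ-shiftʳ G S ιT l)) (val-homo isGroupHomomorphism T l))
  module Ext = Relabel (Identity.isGroupMonomorphism (Group.rawGroup G) refl) S (S ∪ᵍ w̄) (shiftˡ 1)
    (λ l → reflexive (val-∪ᵍ-shiftˡ G S w̄ l))
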